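{- Let $\kappa>\omega$ be a regular cardinal. There are models $\mathcal M_1\subseteq\mathcal M_2$ (a model and a submodel, in a common vocabulary) with $\mathcal M_1\neq\mathcal M_2$ and $|\mathcal M_1|=|\mathcal M_2|=\kappa$ such that (i) for every subset $A$ of the universe of $\mathcal M_1$ with $|A|<\kappa$, there is an isomorphism from $\mathcal M_2$ onto $\mathcal M_1$ which is the identity on $A$; (ii) $\sigma(\mathcal M_1)\le\kappa$.
   Context: $|\mathcal M|$ denotes the cardinality of the universe of $\mathcal M$, and $\sigma(\mathcal M)$ denotes the number of automorphisms of $\mathcal M$. In this statement no restriction is placed on the vocabulary; it may contain relation symbols of infinite arity less than $\kappa$. -}

module Defs where

open import Level using (Level; suc)
open import Data.Fin using (Fin)
open import Data.Nat using (ℕ)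
open import Data.Product using (Σ; Σ-syntax; ∃-syntax; _×_; _,_; proj₁; proj₂)
open import Function using (_∘_)
open import Function.Bundles using (_↣_; _⤖_; _⇔_; Injection; Bijection)
open import Induction.WellFounded using (WellFounded)
open import Relation.Binary using (Rel; IsStrictTotalOrder; Setoid)
open import Relation.Binary.PropositionalEquality using (_≡_; refl; sym; trans; setoid)
open import Relation.Nullary using (¬_)
open import Relation.Unary using (Pred; Irrelevant; _∈_)

private
  variable
    a b ℓ : Level

infix 4 _≺_

-- |A| < |B|, as the strict part of the preorder |A| ≤ |B|.
_≺_ : Set a → Set b → Set _
A ≺ B = (A ↣ B) × ¬ (B ↣ A)

-- A cardinal is an initial ordinal: a well-order none of whose proper
-- initial segments has the size of the whole.
record Cardinal ℓ : Set (suc ℓ) where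
  infix 4 _<_
  field
    Carrier            : Set ℓ
    _<_                : Rel Carrier ℓ
    isStrictTotalOrder : IsStrictTotalOrder _≡_ _<_
    wellFounded        : WellFounded _<_
    initial            : ∀ α → (Σ[ β ∈ Carrier ] β < α) ≺ Carrier

∣_∣ : Cardinal ℓ → Set ℓ
∣ κ ∣ = Cardinal.Carrier κ

module _ (κ : Cardinal ℓ) where
  open Cardinal κ

  Cofinal : {I : Set ℓ} → (I → Carrier) → Set ℓ
  Cofinal {I} f = ∀ α → ∃[ i ] ¬ (f i < α)

  record Regular : Set (suc ℓ) where
    field
      infinite   : ℕ ↣ Carrier
      notCofinal : (I : Set ℓ) → I ≺ Carrier → (f : I → Carrier) → ¬ Cofinal f

-- Arities of relation symbols are sets of size < κ; an n-tuple is a function on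
-- the arity, so that infinite tuples are covered.
record Vocabulary {ℓ} (κ : Cardinal ℓ) : Set (suc ℓ) where
  field
    FunSym   : Set ℓ
    funArity : FunSym → ℕ
    RelSym   : Set ℓ
    relArity : RelSym → Set ℓ
    relSmall : ∀ R → relArity R ≺ ∣ κ ∣

module _ {κ : Cardinal ℓ} (L : Vocabulary κ) where
  open Vocabulary L

  record Structure : Set (suc ℓ) where
    field
      Carrier : Set ℓ
      fun     : (f : FunSym) → (Fin (funArity f) → Carrier) → Carrier
      rel     : (R : RelSym) → (relArity R → Carrier) → Set ℓ

module _ {κ : Cardinal ℓ} {L : Vocabulary κ} where
  open Vocabulary L

  record Isomorphism (M N : Structure L) : Set ℓ where
    private
      module M = Structure M
      module N = Structure N
    field
      bijection : M.Carrier ⤖ N.Carrier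
    open Bijection bijection public using (to)
    field
      fun-pres : ∀ f xs → to (M.fun f xs) ≡ N.fun f (to ∘ xs)
      rel-pres : ∀ R xs → M.rel R xs ⇔ N.rel R (to ∘ xs)

  -- Two automorphisms count as the same when their underlying maps agree
  -- pointwise; the proof components do not matter.
  Automorphisms : Structure L → Setoid ℓ ℓ
  Automorphisms M = record
    { Carrier       = Isomorphism M M
    ; _≈_           = λ g h → ∀ x → to g x ≡ to h x
    ; isEquivalence = record
        { refl  = λ _ → refl
        ; sym   = λ p x → sym (p x)
        ; trans = λ p q x → trans (p x) (q x)
        }
    }
    where open Isomorphism

  -- Irrelevance makes the universe of the submodel, Σ Carrier Domain, a genuine
  -- subset of the universe of M.
  record Submodel (M : Structure L) : Set (suc ℓ) where
    open Structure M
    field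
      Domain     : Pred Carrier ℓ
      irrelevant : Irrelevant Domain
      closed     : ∀ f xs → (∀ i → xs i ∈ Domain) → fun f xs ∈ Domain

    model : Structure L
    model = record
      { Carrier = Σ Carrier Domain
      ; fun     = λ f xs → fun f (proj₁ ∘ xs) , closed f (proj₁ ∘ xs) (proj₂ ∘ xs)
      ; rel     = λ R xs → rel R (proj₁ ∘ xs)
      }

    Proper : Set ℓ
    Proper = ¬ (∀ x → x ∈ Domain)

{-# OPTIONS --safe #-}
-- Let U be a point ∗ together with κ disjoint chains (α , 0), (α , 1), …, and let
-- V = U ∖ {∗}.  The map shift α : U → V sends ∗ to (α , 0), moves chain α one step up
-- and fixes everything else.  Give U the countable-arity relations "some word in the
-- maps shift α and their inverses carries the tuple b to the tuple a", for every a.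
-- Each shift α is then an isomorphism of U onto V, and a subset of V of size < κ
-- misses a whole chain α, so that shift α fixes it pointwise.
--
-- An automorphism agrees on every countable tuple with some word, and a word moves
-- points of finitely many chains only.  Hence an automorphism fixes all but finitely
-- many chains (otherwise take moved points on infinitely many chains), and on each of
-- those it is given by a word: it is coded by a finite list of pairs (α , word), and
-- there are κ such lists.
module Submission where

open import Defs
open import Axiom.ExcludedMiddle using (ExcludedMiddle)
open import Axiom.Extensionality.Propositional
  using (Extensionality; implicit-extensionality)
open import Data.Bool using (Bool; true; false)
open import Data.Empty using (⊥-elim)
import Data.Empty.Polymorphic as Empty
open import Data.List using (List; []; _∷_; map; fromMaybe)
open import Data.List.Membership.Propositional using ()
  renaming (_∈_ to _∈ˡ_; _∉_ to _∉ˡ_)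
open import Data.List.Membership.Propositional.Properties using (∈-map⁺; ∈-map⁻)
open import Data.List.Relation.Unary.Any using (here; there)
open import Data.Maybe using (Maybe; just; nothing)
open import Data.Maybe.Properties using (just-injective)
open import Data.Nat using (ℕ; zero; suc; _≤_; _≤′_; ≤′-refl; ≤′-step; _⊔_)
import Data.Nat.Properties as ℕ
open import Data.Product using (Σ; Σ-syntax; ∃-syntax; _×_; _,_; proj₁; proj₂)
open import Data.Product.Properties using (,-injective)
open import Data.Product.Relation.Binary.Lex.Strict
  using (×-Lex; ×-compare; ×-wellFounded)
open import Data.Sum using (_⊎_; inj₁; inj₂)
import Data.Unit.Polymorphic as Unit
open import Function using (_∘_; _on_)
open import Function.Bundles
  using (_↣_; _⤖_; Injection; Equivalence; mk↣; mk⤖; mk⇔)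
open import Function.Construct.Composition using (_↣-∘_)
open import Function.Construct.Identity using (↣-id)
open import Function.Definitions using (Injective)
open import Induction.WellFounded using (WellFounded; WfRec; module All; module FixPoint)
open import Level using (Level; Lift; lift; lower)
open import Relation.Binary using (Rel; IsStrictTotalOrder; tri<; tri≈; tri>)
import Relation.Binary.Construct.On as On
open import Relation.Binary.PropositionalEquality
  using (_≡_; _≢_; refl; sym; trans; cong; subst; setoid)
open import Relation.Nullary using (¬_; yes; no)
open import Relation.Unary using (Pred; Irrelevant; _∈_)

private
  variable
    a b : Level
    A : Set a
    B : Set b

-- Classical reasoning and least elements.

module Classical {ℓ} (em : ExcludedMiddle ℓ) where

  byContradiction : {P : Set ℓ} → ¬ ¬ P → P
  byContradiction {P} ¬¬p with em {P}
  ... | yes p = p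
  ... | no ¬p = ⊥-elim (¬¬p ¬p)

  least : {X : Set ℓ} {_<_ : Rel X ℓ} → WellFounded _<_ →
          (P : Pred X ℓ) → ∃[ x ] P x → ∃[ x ] (P x × (∀ y → y < x → ¬ P y))
  least wf P (x , px) = byContradiction λ none →
    All.wfRec wf ℓ (λ x → ¬ P x) (λ x ih px → none (x , px , λ y y<x → ih y<x)) x px

  -- The order of a cardinal need not be proof-irrelevant; this picks one proof.
  canonical : {P : Set ℓ} → P → P
  canonical {P} p with em {P}
  ... | yes q = q
  ... | no ¬p = ⊥-elim (¬p p)

  canonical-constant : {P : Set ℓ} (p q : P) → canonical p ≡ canonical q
  canonical-constant {P} p q with em {P}
  ... | yes _ = refl
  ... | no ¬p = ⊥-elim (¬p p)

-- Arithmetic of a regular uncountable cardinal.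

module CardinalArithmetic {ℓ} (em : ExcludedMiddle ℓ) (ext : Extensionality ℓ ℓ)
  (κ : Cardinal ℓ) (regular : Regular κ) (ℕ≺κ : ℕ ≺ ∣ κ ∣) where

  open Classical em
  open Cardinal κ public renaming (Carrier to K)
  open IsStrictTotalOrder isStrictTotalOrder public
    using (compare; _≟_; asym) renaming (trans to <-trans)
  open Regular regular public using (infinite)
  open Regular regular using (notCofinal)

  connected : ∀ α β → α < β ⊎ α ≡ β ⊎ β < α
  connected α β with compare α β
  ... | tri< lt _ _ = inj₁ lt
  ... | tri≈ _ eq _ = inj₂ (inj₁ eq)
  ... | tri> _ _ gt = inj₂ (inj₂ gt)

  ≮∧≯⇒≡ : ∀ {α β} → ¬ (α < β) → ¬ (β < α) → α ≡ β
  ≮∧≯⇒≡ {α} {β} α≮β β≮α with connected α β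
  ... | inj₁ lt        = ⊥-elim (α≮β lt)
  ... | inj₂ (inj₁ eq) = eq
  ... | inj₂ (inj₂ gt) = ⊥-elim (β≮α gt)

  -- The negation expresses that `P` has fewer than κ elements. Injectivity is asked in `X`, so that
  -- different proofs of `P` for one point do not count twice.
  ContainsCopy : {X : Set ℓ} → Pred X ℓ → Set ℓ
  ContainsCopy {X} P = Σ[ h ∈ (K → X) ] Injective _≡_ _≡_ h × (∀ α → P (h α))

  segment-small : ∀ γ → ¬ ContainsCopy (_< γ)
  segment-small γ (h , inj , below) =
    proj₂ (initial γ) (mk↣ {to = λ α → h α , below α} (inj ∘ cong proj₁))

  abstract
    bounded : {I : Set ℓ} → I ≺ K → (f : I → K) → ∃[ β ] (∀ i → f i < β)
    bounded {I} I≺K f = byContradiction λ unbounded →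
      notCofinal I I≺K f λ α → byContradiction λ none →
      unbounded (α , λ i → byContradiction λ f≮α → none (i , f≮α))

  -- The greedy map sends x to the least element of κ not used by the predecessors
  -- of x.
  module Greedy {X : Set ℓ} (_⊏_ : Rel X ℓ) (wf : WellFounded _⊏_)
    (⊏-connected : ∀ x y → x ⊏ y ⊎ x ≡ y ⊎ y ⊏ x)
    (small : ∀ x → ¬ ContainsCopy (_⊏ x)) where

    private
      -- Passing through `canonical` makes the recursive value depend on `y` alone and not on the
      -- proof of `y ⊏ x`.
      Image : ∀ x → WfRec _⊏_ (λ _ → K) x → Pred K ℓ
      Image x ih α = Σ[ y ∈ X ] Σ[ y⊏x ∈ y ⊏ x ] ih (canonical y⊏x) ≡ α

      -- Otherwise a choice of preimages would embed κ into the predecessors of `x`.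
      someNew : ∀ x (ih : WfRec _⊏_ (λ _ → K) x) → ∃[ α ] ¬ Image x ih α
      someNew x ih = byContradiction λ none →
        let hit : ∀ α → Image x ih α
            hit α = byContradiction λ ¬hit → none (α , ¬hit)
        in small x ( proj₁ ∘ hit
                   , (λ {α} {β} → injective (hit α) (hit β))
                   , proj₁ ∘ proj₂ ∘ hit )
        where
        injective : ∀ {α β} (p : Image x ih α) (q : Image x ih β) →
                    proj₁ p ≡ proj₁ q → α ≡ β
        injective (y , p , refl) (.y , q , refl) refl = cong ih (canonical-constant p q)

      step : ∀ x (ih : WfRec _⊏_ (λ _ → K) x) →
             ∃[ α ] (¬ Image x ih α × (∀ β → β < α → ¬ ¬ Image x ih β))
      step x ih = least wellFounded _ (someNew x ih)

      step-ext : ∀ x {ih ih′ : WfRec _⊏_ (λ _ → K) x} →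
                 (∀ {y} (y⊏x : y ⊏ x) → ih y⊏x ≡ ih′ y⊏x) →
                 proj₁ (step x ih) ≡ proj₁ (step x ih′)
      step-ext x eq = cong (λ (ih : WfRec _⊏_ (λ _ → K) x) → proj₁ (step x ih))
        (implicit-extensionality ext (ext eq))

      module Fix = FixPoint wf (λ _ → K) (λ x ih → proj₁ (step x ih)) step-ext

    abstract
      to : X → K
      to = All.wfRec wf ℓ (λ _ → K) (λ x ih → proj₁ (step x ih))

      to-new : ∀ {x y} → y ⊏ x → to y ≢ to x
      to-new {x} y⊏x eq =
        proj₁ (proj₂ (step x (λ {y} _ → to y))) (_ , y⊏x , trans eq Fix.unfold-wfRec)

      to-least : ∀ x β → β < to x → ∃[ y ] to y ≡ β
      to-least x β β<to = byContradiction λ none →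
        proj₂ (proj₂ (step x (λ {y} _ → to y))) β
          (subst (β <_) Fix.unfold-wfRec β<to)
          λ (y , _ , eq) → none (y , eq)

    to-injective : Injective _≡_ _≡_ to
    to-injective {x} {y} eq with ⊏-connected x y
    ... | inj₁ x⊏y        = ⊥-elim (to-new x⊏y eq)
    ... | inj₂ (inj₁ x≡y) = x≡y
    ... | inj₂ (inj₂ y⊏x) = ⊥-elim (to-new y⊏x (sym eq))

    -- The image is an initial segment of κ, and a proper one is too small.
    to-surjective : K ↣ X → ∀ α → ∃[ x ] to x ≡ α
    to-surjective k α = byContradiction λ none → segment-small α
      ( to ∘ Injection.to k
      , Injection.injective k ∘ to-injective
      , below none ∘ Injection.to k )
      where
      below : ¬ (∃[ x ] to x ≡ α) → ∀ x → to x < α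
      below none x with connected (to x) α
      ... | inj₁ lt        = lt
      ... | inj₂ (inj₁ eq) = ⊥-elim (none (x , eq))
      ... | inj₂ (inj₂ gt) = ⊥-elim (none (to-least x α gt))

    bijection : K ↣ X → X ⤖ K
    bijection k = mk⤖ (to-injective , λ α →
      let (x , eq) = to-surjective k α in x , λ z≡x → trans (cong to z≡x) eq)

  -- The order of κ pulled back along the first injection has small initial segments, so the greedy
  -- map applies; the second injection makes it onto.
  cantor-bernstein : {X : Set ℓ} → X ↣ K → K ↣ X → X ⤖ K
  cantor-bernstein {X} i = Greedy.bijection
    (_<_ on to) (On.wellFounded to wellFounded) connected′
    (λ x (h , inj , below) → segment-small (to x) (to ∘ h , inj ∘ injective , below))
    where
    open Injection i
    connected′ : ∀ x y → to x < to y ⊎ x ≡ y ⊎ to y < to x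
    connected′ x y with connected (to x) (to y)
    ... | inj₁ lt        = inj₁ lt
    ... | inj₂ (inj₁ eq) = inj₂ (inj₁ (injective eq))
    ... | inj₂ (inj₂ gt) = inj₂ (inj₂ gt)

  -- By regularity, a copy of κ in γ × γ has < κ fibres over the first coordinate,
  -- each of them bounded.
  square-of-segment-small : ∀ γ → ¬ ContainsCopy {K × K} (λ (α , β) → α < γ × β < γ)
  square-of-segment-small γ (h , inj , below) =
    -- `δ` lies in the fibre over the first coordinate of `h δ`, hence below the bound of that
    -- fibre, yet it exceeds all these bounds.
    asym (sup-bounds (proj₁ (h δ) , proj₁ (below δ)))
         (bound-bounds (proj₁ (h δ) , proj₁ (below δ)) (δ , refl))
    where
    Fibre : Σ[ α ∈ K ] α < γ → Set ℓ
    Fibre (α , _) = Σ[ ξ ∈ K ] proj₁ (h ξ) ≡ α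

    fibre-≡ : ∀ i {p q : Fibre i} → proj₁ p ≡ proj₁ q → p ≡ q
    fibre-≡ _ {p = ξ , refl} {q = .ξ , refl} refl = refl

    fibre≺K : ∀ i → Fibre i ≺ K
    fibre≺K i = mk↣ {to = proj₁} (fibre-≡ i) , λ k →
      -- Within a fibre the second coordinate is injective, so a fibre of size κ would embed κ below
      -- `γ`.
      let open Injection k in segment-small γ
        ( proj₂ ∘ h ∘ proj₁ ∘ to
        , (λ {ξ} {ζ} eq → injective (fibre-≡ i (inj
             (×-≡ (trans (proj₂ (to ξ)) (sym (proj₂ (to ζ)))) eq))))
        , proj₂ ∘ below ∘ proj₁ ∘ to )
      where
      ×-≡ : {p q : K × K} → proj₁ p ≡ proj₁ q → proj₂ p ≡ proj₂ q → p ≡ q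
      ×-≡ refl refl = refl

    bound : Σ[ α ∈ K ] α < γ → K
    bound i = proj₁ (bounded (fibre≺K i) proj₁)

    bound-bounds : ∀ i (p : Fibre i) → proj₁ p < bound i
    bound-bounds i = proj₂ (bounded (fibre≺K i) proj₁)

    δ : K
    δ = proj₁ (bounded (initial γ) bound)

    sup-bounds : ∀ i → bound i < δ
    sup-bounds = proj₂ (bounded (initial γ) bound)

  Liftℕ≺K : Lift ℓ ℕ ≺ K
  Liftℕ≺K = mk↣ {to = Injection.to infinite ∘ lower}
              (cong lift ∘ Injection.injective infinite)
          , λ k → proj₂ ℕ≺κ
              (mk↣ {to = lower ∘ Injection.to k} (Injection.injective k ∘ cong lift))

  upperBound : ((α , β) : K × K) → ∃[ γ ] (α < γ × β < γ)
  upperBound (α , β) = proj₁ bound , proj₂ bound (lift 0) , proj₂ bound (lift 1)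
    where
    bound : ∃[ γ ] (∀ i → _ < γ)
    -- The pair is treated as a countable family that repeats `β`.
    bound = bounded Liftℕ≺K λ { (lift zero) → α ; (lift (suc _)) → β }

  -- Pairs are ordered by an upper bound of their entries first, which puts every
  -- initial segment inside the square of a segment of κ.
  abstract
    pair : (K × K) ↣ K
    pair = mk↣ (Greedy.to-injective (_⊏_ on key) (On.wellFounded key ⊏-wellFounded)
                                    connected′ small)
      where
      key : K × K → K × K × K
      key p = proj₁ (upperBound p) , p

      _⊏_ : Rel (K × K × K) ℓ
      _⊏_ = ×-Lex _≡_ _<_ (×-Lex _≡_ _<_ _<_)

      ⊏-wellFounded : WellFounded _⊏_
      ⊏-wellFounded = ×-wellFounded wellFounded (×-wellFounded wellFounded wellFounded)

      connected′ : ∀ p q → key p ⊏ key q ⊎ p ≡ q ⊎ key q ⊏ key p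
      connected′ p q with ×-compare sym compare (×-compare sym compare compare) (key p) (key q)
      ... | tri< lt _ _                  = inj₁ lt
      ... | tri≈ _ (_ , (refl , refl)) _ = inj₂ (inj₁ refl)
      ... | tri> _ _ gt                  = inj₂ (inj₂ gt)

      <-≤ : ∀ {α} p q → key p ⊏ key q → α < proj₁ (key p) → α < proj₁ (key q)
      <-≤ _ _ (inj₁ lt)       α< = <-trans α< lt
      <-≤ _ _ (inj₂ (eq , _)) α< = subst (_ <_) eq α<

      small : ∀ p → ¬ ContainsCopy (λ q → key q ⊏ key p)
      small p (h , inj , below) = square-of-segment-small (proj₁ (key p))
        ( h , inj , λ α → let (l , r) = proj₂ (upperBound (h α)) in
            <-≤ (h α) p (below α) l , <-≤ (h α) p (below α) r )

  ⟨_,_⟩ : K → K → K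
  ⟨ α , β ⟩ = Injection.to pair (α , β)

  ⟨,⟩-injective : ∀ {α β γ δ} → ⟨ α , β ⟩ ≡ ⟨ γ , δ ⟩ → α ≡ γ × β ≡ δ
  ⟨,⟩-injective = ,-injective ∘ Injection.injective pair

  -- Codes in κ for finite data.

  ×-code : A ↣ K → B ↣ K → (A × B) ↣ K
  ×-code {A = A} {B = B} f g = mk↣ {to = code} (λ {p} {q} → injective p q)
    where
    module F = Injection f
    module G = Injection g
    code : A × B → K
    code (x , y) = ⟨ F.to x , G.to y ⟩
    injective : ∀ p q → code p ≡ code q → p ≡ q
    injective (x , y) (x′ , y′) eq with ⟨,⟩-injective eq
    ... | p , q with F.injective p | G.injective q
    ... | refl | refl = refl

  private
    module N = Injection infinite

  Bool-code : Bool ↣ K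
  Bool-code = mk↣ {to = code} (λ {x} {y} → injective x y)
    where
    code : Bool → K
    code false = N.to 0
    code true  = N.to 1
    injective : ∀ x y → code x ≡ code y → x ≡ y
    injective false false _  = refl
    injective true  true  _  = refl
    injective false true  eq with () ← N.injective eq
    injective true  false eq with () ← N.injective eq

  List-code : A ↣ K → List A ↣ K
  List-code {A = A} f = mk↣ {to = code} (λ {x} {y} → injective x y)
    where
    module F = Injection f
    code : List A → K
    -- The first component is a tag telling empty from nonempty lists; the second one is filler
    -- here.
    code []       = ⟨ N.to 0 , N.to 0 ⟩
    code (x ∷ xs) = ⟨ N.to 1 , ⟨ F.to x , code xs ⟩ ⟩
    injective : ∀ xs ys → code xs ≡ code ys → xs ≡ ys
    injective []       []       _  = refl
    injective []       (_ ∷ _)  eq with () ← N.injective (proj₁ (⟨,⟩-injective eq))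
    injective (_ ∷ _)  []       eq with () ← N.injective (proj₁ (⟨,⟩-injective eq))
    injective (x ∷ xs) (y ∷ ys) eq with ⟨,⟩-injective (proj₂ (⟨,⟩-injective eq))
    ... | p , q with F.injective p | injective xs ys q
    ... | refl | refl = refl

  Maybe-code : A ↣ K → Maybe A ↣ K
  Maybe-code {A = A} f = List-code f ↣-∘ mk↣ {to = fromMaybe} (λ {x} {y} → injective x y)
    where
    injective : (x y : Maybe A) → fromMaybe x ≡ fromMaybe y → x ≡ y
    injective nothing  nothing  _    = refl
    injective (just _) (just _) refl = refl

-- Chains and shifts.

module Construction {ℓ} (em : ExcludedMiddle ℓ) (ext : Extensionality ℓ ℓ)
  (κ : Cardinal ℓ) (regular : Regular κ) (ℕ≺κ : ℕ ≺ ∣ κ ∣) where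

  open Classical em
  open CardinalArithmetic em ext κ regular ℕ≺κ

  -- `nothing` is the extra point ∗.
  Point : Set ℓ
  Point = Maybe (K × ℕ)

  shift : K → Point → K × ℕ
  shift α nothing        = α , 0
  shift α (just (β , n)) with β ≟ α
  ... | yes _ = β , suc n
  ... | no  _ = β , n

  shift-moves : ∀ α n → shift α (just (α , n)) ≡ (α , suc n)
  shift-moves α n with α ≟ α
  ... | yes _   = refl
  ... | no  α≢α = ⊥-elim (α≢α refl)

  shift-fixes : ∀ {α β} n → β ≢ α → shift α (just (β , n)) ≡ (β , n)
  shift-fixes {α} {β} n β≢α with β ≟ α
  ... | yes β≡α = ⊥-elim (β≢α β≡α)
  ... | no  _   = refl

  shift-injective : ∀ α → Injective _≡_ _≡_ (shift α)
  shift-injective α {x} {y} = go x y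
    where
    go : ∀ x y → shift α x ≡ shift α y → x ≡ y
    go nothing nothing _ = refl
    go nothing (just (γ , m)) eq with γ ≟ α
    go nothing (just (γ , m)) ()   | yes _
    go nothing (just (γ , m)) refl | no α≢α = ⊥-elim (α≢α refl)
    go (just (β , n)) nothing eq with β ≟ α
    go (just (β , n)) nothing ()   | yes _
    go (just (β , n)) nothing refl | no α≢α = ⊥-elim (α≢α refl)
    go (just (β , n)) (just (γ , m)) eq with β ≟ α | γ ≟ α
    go (just (β , n)) (just (γ , m)) refl | yes _   | yes _   = refl
    go (just (β , n)) (just (γ , m)) refl | yes β≡α | no  γ≢α = ⊥-elim (γ≢α β≡α)
    go (just (β , n)) (just (γ , m)) refl | no  β≢α | yes γ≡α = ⊥-elim (β≢α γ≡α)
    go (just (β , n)) (just (γ , m)) refl | no  _   | no  _   = refl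

  shift-surjective : ∀ α p → ∃[ x ] shift α x ≡ p
  shift-surjective α (β , n) with β ≟ α
  shift-surjective α (β , zero)  | yes refl = nothing , refl
  shift-surjective α (β , suc n) | yes refl = just (β , n) , shift-moves β n
  shift-surjective α (β , n)     | no  β≢α  = just (β , n) , shift-fixes n β≢α

  -- Words in the shifts and their inverses.

  Word : Set ℓ
  Word = List (K × Bool)

  letters : Word → List K
  letters = map proj₁

  -- A relation rather than a function, since the inverse of a shift (letter `false`) is undefined
  -- at `nothing`.
  Step : K × Bool → Rel Point ℓ
  Step (α , true)  x y = just (shift α x) ≡ y
  Step (α , false) x y = just (shift α y) ≡ x

  Path : Word → Rel Point ℓ
  Path []      x y = x ≡ y
  Path (s ∷ w) x y = ∃[ z ] (Step s x z × Path w z y)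

  step-injective : ∀ s {x x′ y} → Step s x y → Step s x′ y → x ≡ x′
  step-injective (α , true)  p q = shift-injective α (just-injective (trans p (sym q)))
  step-injective (α , false) p q = trans (sym p) q

  path-injective : ∀ w {x x′ y} → Path w x y → Path w x′ y → x ≡ x′
  path-injective []      p q = trans p (sym q)
  path-injective (s ∷ w) (z , p , ps) (z′ , q , qs) with path-injective w ps qs
  ... | refl = step-injective s p q

  step-fixes : ∀ s {β n x} → β ≢ proj₁ s → Step s x (just (β , n)) → x ≡ just (β , n)
  step-fixes (α , true)  β≢α p =
    shift-injective α (trans (just-injective p) (sym (shift-fixes _ β≢α)))
  step-fixes (α , false) β≢α p = trans (sym p) (cong just (shift-fixes _ β≢α))

  -- Read backwards from its end, the path never leaves the point, as each letter belongs to another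
  -- chain.
  path-fixes : ∀ w {β n x} → β ∉ˡ letters w → Path w x (just (β , n)) → x ≡ just (β , n)
  path-fixes []      _  p = p
  path-fixes (s ∷ w) β∉ (z , p , ps) with path-fixes w (β∉ ∘ there) ps
  ... | refl = step-fixes s (β∉ ∘ here) p

  -- The two models.

  L : Vocabulary κ
  L = record
    { FunSym   = Empty.⊥
    ; funArity = λ ()
    ; RelSym   = ℕ → Point
    ; relArity = λ _ → Lift ℓ ℕ
    ; relSmall = λ _ → Liftℕ≺K
    }

  M₂ : Structure L
  M₂ = record
    { Carrier = Point
    ; fun     = λ ()
    ; rel     = λ a b → ∃[ w ] (∀ n → Path w (b (lift n)) (a n))
    }

  IsJust : Pred Point ℓ
  IsJust nothing  = Empty.⊥
  IsJust (just _) = Unit.⊤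

  IsJust-irrelevant : Irrelevant IsJust
  IsJust-irrelevant {just _} _ _ = refl

  S : Submodel M₂
  S = record
    { Domain     = IsJust
    ; irrelevant = IsJust-irrelevant
    ; closed     = λ ()
    }

  open Submodel S using () renaming (model to M₁)

  V : Set ℓ
  V = Structure.Carrier M₁

  pt : K × ℕ → V
  pt p = just p , _

  V-≡ : {x y : V} → proj₁ x ≡ proj₁ y → x ≡ y
  V-≡ {just _ , _} {just _ , _} refl = refl

  K↣V : K ↣ V
  K↣V = mk↣ {to = λ α → pt (α , 0)} (cong proj₁ ∘ just-injective ∘ cong proj₁)

  V↣Point : V ↣ Point
  V↣Point = mk↣ {to = proj₁} V-≡

  Point↣K : Point ↣ K
  Point↣K = Maybe-code (×-code (↣-id K) infinite)

  V⤖K : V ⤖ K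
  V⤖K = cantor-bernstein (Point↣K ↣-∘ V↣Point) K↣V

  Point⤖K : Point ⤖ K
  Point⤖K = cantor-bernstein Point↣K (V↣Point ↣-∘ K↣V)

  -- Isomorphisms fixing a small set.

  shiftIso : K → Isomorphism M₂ M₁
  shiftIso α = record
    { bijection = mk⤖ {to = pt ∘ shift α}
        ( shift-injective α ∘ just-injective ∘ cong proj₁
        , λ { (just p , _) → let (x , eq) = shift-surjective α p in
                x , λ { refl → cong pt eq } } )
    ; fun-pres  = λ ()
    ; rel-pres  = λ a b → mk⇔
        -- From the shifted tuple, first undo the shift and then follow the old word; the converse
        -- performs the shift first.
        (λ (w , path) → (α , false) ∷ w , λ n → b (lift n) , refl , path n)
        (λ (w , path) → (α , true)  ∷ w , λ n → _ , refl , path n)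
    }

  -- Otherwise choosing a point of `P` on each of the κ disjoint chains would embed κ into `P`.
  missedChain : (P : Pred V ℓ) → Σ V P ≺ K → ∃[ α ] (∀ n → ¬ P (pt (α , n)))
  missedChain P (_ , K↣̸P) = byContradiction λ none →
    let hit : ∀ α → Σ[ n ∈ Lift ℓ ℕ ] P (pt (α , lower n))
        hit α = byContradiction λ ¬hit → none (α , λ n p → ¬hit (lift n , p))
    in K↣̸P (mk↣ {to = λ α → pt (α , lower (proj₁ (hit α))) , proj₂ (hit α)}
              (cong proj₁ ∘ just-injective ∘ cong (proj₁ ∘ proj₁)))

  fixingIso : (P : Pred V ℓ) → Σ V P ≺ K →
    Σ[ f ∈ Isomorphism M₂ M₁ ] (∀ x → x ∈ P → Isomorphism.to f (proj₁ x) ≡ x)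
  fixingIso P P≺K = shiftIso α , λ { (just (β , n) , _) x∈P →
      cong pt (shift-fixes n λ { refl → missed n x∈P }) }
    where
    α = proj₁ (missedChain P P≺K)
    missed = proj₂ (missedChain P P≺K)

  -- Escaping from the support repeatedly gives a sequence of points on pairwise
  -- distinct chains, so that every finite set of chains is eventually left.
  module Escape {Q : Pred (K × ℕ) ℓ}
    (escape : ∀ αs → ∃[ p ] (proj₁ p ∉ˡ αs × Q p)) where

    visited : ℕ → List K
    visited zero    = []
    visited (suc n) = proj₁ (proj₁ (escape (visited n))) ∷ visited n

    point : ℕ → K × ℕ
    point n = proj₁ (escape (visited n))

    point∈Q : ∀ n → Q (point n)
    point∈Q n = proj₂ (proj₂ (escape (visited n)))

    revisited : ∀ {m n} → suc m ≤′ n → proj₁ (point m) ∈ˡ visited n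
    revisited ≤′-refl       = here refl
    revisited (≤′-step m<n) = there (revisited m<n)

    distinct : ∀ {m n} → suc m ≤ n → proj₁ (point n) ≢ proj₁ (point m)
    distinct {m} {n} m<n eq = proj₁ (proj₂ (escape (visited n)))
      (subst (_∈ˡ visited n) (sym eq) (revisited (ℕ.≤⇒≤′ m<n)))

    leaves : ∀ αs → ∃[ k ] (∀ n → k ≤ n → proj₁ (point n) ∉ˡ αs)
    leaves []       = 0 , λ _ _ ()
    leaves (α ∷ αs) with leaves αs | em {Σ[ m ∈ Lift ℓ ℕ ] proj₁ (point (lower m)) ≡ α}
    -- The sequence meets a chain at most once, so it suffices to go past stage `m` too.
    ... | k , out | yes (lift m , refl) = k ⊔ suc m , λ where
      n k⊔m<n (here eq)  → distinct (ℕ.m⊔n≤o⇒n≤o k (suc m) k⊔m<n) eq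
      n k⊔m<n (there α∈) → out n (ℕ.m⊔n≤o⇒m≤o k (suc m) k⊔m<n) α∈
    ... | k , out | no never = k , λ where
      n k≤n (here eq)  → never (lift n , eq)
      n k≤n (there α∈) → out n k≤n α∈

  -- Finite descriptions of automorphisms.

  Description : Set ℓ
  Description = List (K × Word)

  -- Paths run from the image back to the point, the direction in which the relations supply them.
  Describes : Description → (K × ℕ → Point) → Set ℓ
  Describes d g = (∀ {α w} → (α , w) ∈ˡ d → ∀ n → Path w (g (α , n)) (just (α , n)))
                × (∀ α n → α ∉ˡ map proj₁ d → g (α , n) ≡ just (α , n))

  describes-resp : ∀ {d g h} → (∀ p → g p ≡ h p) → Describes d g → Describes d h
  describes-resp g≗h (local , fixed) =
    (λ {_} {w} e n → subst (λ x → Path w x _) (g≗h _) (local e n)) ,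
    (λ α n α∉ → trans (sym (g≗h _)) (fixed α n α∉))

  -- Words act as partial injections, so on a listed chain the word and the endpoint determine the
  -- image.
  describes-unique : ∀ {d g h} → Describes d g → Describes d h → ∀ p → g p ≡ h p
  describes-unique {d} (local , fixed) (local′ , fixed′) (α , n) with em {α ∈ˡ map proj₁ d}
  ... | no α∉ = trans (fixed α n α∉) (sym (fixed′ α n α∉))
  ... | yes α∈ with ∈-map⁻ proj₁ α∈
  ... | (_ , w) , e , refl = path-injective w (local e n) (local′ e n)

  module _ (g : Isomorphism M₁ M₁) where
    open Isomorphism g using (to; rel-pres)

    act : K × ℕ → Point
    act p = proj₁ (to (pt p))

    -- By the empty word, `c` satisfies the relation that it names itself, and `g` preserves this
    -- relation.
    local : (c : ℕ → K × ℕ) → ∃[ w ] (∀ n → Path w (act (c n)) (just (c n)))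
    local c = Equivalence.to (rel-pres (just ∘ c) (pt ∘ c ∘ lower)) ([] , λ _ → refl)

    -- Otherwise there are moved points on infinitely many chains, but the one word serving them all
    -- has finitely many letters and fixes some of them.
    finiteSupport : ∃[ αs ] (∀ α n → α ∉ˡ αs → act (α , n) ≡ just (α , n))
    finiteSupport = byContradiction λ none →
      let escape : ∀ αs → ∃[ p ] (proj₁ p ∉ˡ αs × act p ≢ just p)
          escape αs = byContradiction λ ¬escape → none (αs , λ α n α∉ →
            byContradiction λ moved → ¬escape ((α , n) , α∉ , moved))
          open Escape escape
          (w , path) = local point
          (k , out)  = leaves (letters w)
      in point∈Q k (path-fixes w (out k ℕ.≤-refl) (path k))

    describable : ∃[ d ] Describes d act
    describable = map entry αs , described , λ α n α∉ →
        fixed α n (α∉ ∘ ∈-map⁺ proj₁ ∘ ∈-map⁺ entry)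
      where
      αs = proj₁ finiteSupport
      fixed = proj₂ finiteSupport

      entry : K → K × Word
      -- The sequence enumerates chain `α`, so one word serves the whole chain.
      entry α = α , proj₁ (local (α ,_))

      described : ∀ {α w} → (α , w) ∈ˡ map entry αs →
                  ∀ n → Path w (act (α , n)) (just (α , n))
      described e n with ∈-map⁻ entry e
      ... | α , _ , refl = proj₂ (local (α ,_)) n

  -- Counting the automorphisms.

  abstract
    Description-code : Description ↣ K
    Description-code = List-code (×-code (↣-id K) (List-code (×-code (↣-id K) Bool-code)))

  private
    module D = Injection Description-code

  -- A predicate, because an automorphism has many descriptions.
  Code : Isomorphism M₁ M₁ → Pred K ℓ
  Code g α = ∃[ d ] (Describes d (act g) × D.to d ≡ α)

  code-resp : ∀ {g h α} → (∀ x → Isomorphism.to g x ≡ Isomorphism.to h x) →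
              Code g α → Code h α
  code-resp g≗h (d , desc , eq) = d , describes-resp (cong proj₁ ∘ g≗h ∘ pt) desc , eq

  code-unique : ∀ {g h α} → Code g α → Code h α →
                ∀ x → Isomorphism.to g x ≡ Isomorphism.to h x
  code-unique (d , desc , eq) (d′ , desc′ , eq′) (just p , _) = V-≡
    (describes-unique desc (subst (λ d → Describes d _) (sym d≡d′) desc′) p)
    where
    d≡d′ : d ≡ d′
    d≡d′ = D.injective (trans eq (sym eq′))

  abstract
    leastCode : ∀ g → ∃[ α ] (Code g α × (∀ β → β < α → ¬ Code g β))
    leastCode g = let (d , desc) = describable g in
      least wellFounded (Code g) (D.to d , d , desc , refl)

  -- Choosing the least code makes it depend on the underlying map only.
  automorphismCode : Injection (Automorphisms M₁) (setoid K)
  automorphismCode = record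
    { to        = proj₁ ∘ leastCode
    ; cong      = λ {g} {h} → respects {g} {h}
    ; injective = λ {g} {h} → injective {g} {h}
    }
    where
    open Isomorphism using (to)

    least-≤ : ∀ {g h} → (∀ x → to g x ≡ to h x) → ¬ (proj₁ (leastCode h) < proj₁ (leastCode g))
    least-≤ {g} {h} g≗h lt = proj₂ (proj₂ (leastCode g)) _ lt
      (code-resp {h} {g} (sym ∘ g≗h) (proj₁ (proj₂ (leastCode h))))

    respects : ∀ {g h} → (∀ x → to g x ≡ to h x) → proj₁ (leastCode g) ≡ proj₁ (leastCode h)
    respects {g} {h} g≗h =
      ≮∧≯⇒≡ (least-≤ {h} {g} (sym ∘ g≗h)) (least-≤ {g} {h} g≗h)

    injective : ∀ {g h} → proj₁ (leastCode g) ≡ proj₁ (leastCode h) → ∀ x → to g x ≡ to h x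
    injective {g} {h} eq = code-unique {g} {h}
      (proj₁ (proj₂ (leastCode g)))
      (subst (Code h) (sym eq) (proj₁ (proj₂ (leastCode h))))

theorem7 : ∀ {ℓ} → ExcludedMiddle ℓ → Extensionality ℓ ℓ →
    (κ : Cardinal ℓ) → Regular κ → ℕ ≺ ∣ κ ∣ →
    Σ[ L ∈ Vocabulary κ ] Σ[ M₂ ∈ Structure L ] Σ[ S ∈ Submodel M₂ ]
    let M₁ = Submodel.model S in
    Submodel.Proper S ×
    (Structure.Carrier M₁ ⤖ ∣ κ ∣) ×
    (Structure.Carrier M₂ ⤖ ∣ κ ∣) ×
    ((A : Pred (Structure.Carrier M₁) ℓ) → Irrelevant A →
    Σ (Structure.Carrier M₁) A ≺ ∣ κ ∣ →
    Σ[ f ∈ Isomorphism M₂ M₁ ]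
    (∀ x → x ∈ A → Isomorphism.to f (proj₁ x) ≡ x)) ×
    Injection (Automorphisms M₁) (setoid ∣ κ ∣)
theorem7 em ext κ regular ℕ≺κ =
  L , M₂ , S , (λ all → Empty.⊥-elim (all nothing)) , V⤖K , Point⤖K ,
  (λ P _ → fixingIso P) , automorphismCode
  where open Construction em ext κ regular ℕ≺κ
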